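{- Let $\varphi$ be a minimal counterexample to Vaught's conjecture and let $\lambda\in S^\circ=\mathfrak F\cap C_{5.3}\cap(\mathrm{qr}(\varphi),\omega_1)$. Let $M,M'$ be fiber models at $\lambda$, let $q$ be an $n$-type of $T_\lambda$ realized in both $M$ and $M'$, and put $\Gamma:=\Phi_M(q)$. If $\Gamma$ is $\Sigma^{\mathrm{in}}_\lambda$-supported within $M$ by a formula $\theta$, then $\Phi_{M'}(q)=\Gamma$, and the same $\theta$ supports $\Gamma$ within $M'$.
   Context: Structures are countable structures in a countable vocabulary; classes of models are counted up to isomorphism. $\Sigma^{\mathrm{in}}_0=\Pi^{\mathrm{in}}_0$ is the set of finitary quantifier-free formulas; for $\alpha>0$, $\Sigma^{\mathrm{in}}_\alpha$ consists of countable disjunctions of formulas $\exists\bar x\,\psi$ with $\psi\in\Pi^{\mathrm{in}}_\beta$, $\beta<\alpha$, and $\Pi^{\mathrm{in}}_\alpha$ is dual. $M\equiv_\alpha N$: $M,N$ satisfy the same $\Pi^{\mathrm{in}}_\alpha$ (equivalently $\Sigma^{\mathrm{in}}_\alpha$) sentences. A Scott sentence of $M$ is an $L_{\omega_1\omega}$ sentence whose countable models are exactly the copies of $M$. $\mathrm{cSR}(M)$: the least $\alpha$ such that $M$ has a $\Pi^{\mathrm{in}}_{\alpha+1}$ Scott sentence. $\omega_1^A=\min\{\omega_1^X: X\in 2^\omega\text{ computes a copy of }A\}$. $\mathrm{qr}(S)$: the least $\beta$ with $S\in\Pi^{\mathrm{in}}_\beta\cup\Sigma^{\mathrm{in}}_\beta$.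 Standing hypotheses: Vaught's conjecture fails, and $\varphi$ is a minimal counterexample: an $L_{\omega_1\omega}$ sentence with exactly $\aleph_1$ countable models up to isomorphism, scattered (for each $\alpha<\omega_1$ at most countably many $\equiv_\alpha$-classes among its models), and such that for every $L_{\omega_1\omega}$ sentence $\psi$ one of $\varphi\wedge\psi$, $\varphi\wedge\neg\psi$ has only countably many models. Moreover for each $\alpha<\omega_1$ only countably many $\Sigma^{\mathrm{in}}_\alpha$-types are realized in models of $\varphi$. For each $\beta<\omega_1$ exactly one $\equiv_\beta$-class of models of $\varphi$ is uncountable, denoted $\mathcal C_\beta$. $f(\alpha)=\min\{\beta:(\forall M\models\varphi)(M\notin\mathcal C_\alpha\Rightarrow\mathrm{cSR}(M)<\beta)\}$, $\mathfrak F=\{\alpha<\omega_1:f(\alpha)\le\alpha\}$. Sacks rank. A fragment is a countable set of $L_{\omega_1\omega}$ formulas closed under subformulas, substitution and the finitary connectives and quantifiers. For a structure $A$: $L^A_0$ is the finitary language; $T^A_\delta=\mathrm{Th}_{L^A_\delta}(A)$; $L^A_{\delta+1}$ is the least fragment containing $L^A_\delta$ and $\bigwedge p$ for every non-principal complete $L^A_\delta$-type $p$ realized in $A$; unions at limits. $\mathrm{sr}_{\mathrm{Sacks}}(A)$ is the least $\delta$ such that $A$ is the atomic model of $T^A_\delta$. Tree of nodes. $L_0$ is the fragment generated by $\varphi$, and $T$ is $\{\varphi\}$ together with the tautologies of $L_0$. A theory $T'$ in a fragment $L'$ is $\omega$-complete if for each sentence $F\in L'$, $F\in T'$ or $\neg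 F\in T'$, and whenever $\bigvee_iF_i\in T'$, some $F_i\in T'$; it is finitarily consistent if no contradiction is derivable from it by finite-length deductions. Nodes on level $0$: finitarily consistent $\omega$-complete extensions of $T$ in $L_0$. An $n$-type of a node $S$ (in fragment $L_S$) is a maximal set of $L_S(\bar x)$-formulas finitarily consistent with $S$; it is principal if generated over $S$ by one of its formulas. Nodes on level $\delta+1$: finitarily consistent $\omega$-complete extensions of a level-$\delta$ node $S$ in $L'_S$, the least fragment containing $L_S$ and $\bigwedge p$ for each non-principal $n$-type $p$ of $S$. Nodes on limit levels: unions along chains. Every model of a node is a model of $\varphi$. Fixed data, supplied by theorems of Sacks (Bounds on weak scattering, Thm. 4.9, Prop. 5.2 and Thm. 5.3): an increasing branch $(T_\delta)_{\delta<\omega_1}$ of nodes, $T_\delta$ on level $\delta$ with fragment $L_{T_\delta}$, unions at limits, $\Delta_1$ over $L(\omega_1,T)$, such that every $T_\delta$ has an atomic model $A_\delta$ of $\mathrm{sr}_{\mathrm{Sacks}}$ exactly $\delta$, and $A_{\delta+1}$ realizes a non-principal type of $T_\delta$; and a club $C_{5.3}\subseteq\omega_1$ (the ordinals $\omega_1^{L(\beta_\delta,T)}$ for the transitive collapses $L(\beta_\delta,T)$ of the $\Sigma_1$-hulls in Sacks' proof) such that for each $\lambda\in C_{5.3}$: $\lambda>\omega$ and $L(\lambda,T)$ is $\Sigma_1$-admissible; $B_\lambda\models T_\lambda$ realizes every non-principal $n$-type of $T_\lambda$, $\omega_1^{B_\lambda}=\lambda$ and $\mathrm{sr}_{\mathrm{Sacks}}(B_\lambda)=\lambda+1$.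 Fiber models at $\lambda$: countable $M\models T_\lambda$ with $\omega_1^M=\lambda$. For a fiber model $M$ and an $n$-type $q$ of $T_\lambda$ realized in $M$, $\Phi_M(q)$ is the complete $\Pi^{\mathrm{in}}_\lambda$-type (set of all $\Pi^{\mathrm{in}}_\lambda$ formulas satisfied) of any realizer of $q$ in $M$; this is well defined because any two realizers of $q$ in $M$ are automorphic. A set $\Gamma(\bar x)$ of $\Pi^{\mathrm{in}}_\lambda$ formulas is $\Sigma^{\mathrm{in}}_\lambda$-supported within $M$ by $\theta$ if $\theta(\bar x)$ is a (parameter-free) $\Sigma^{\mathrm{in}}_\lambda$ formula with $M\models\exists\bar x\,\theta$ and $M\models\forall\bar x(\theta\to\gamma)$ for every $\gamma\in\Gamma$.
   Formalization: The n-types of a node are required to be ω-complete, as nodes are; with merely maximal finitarily consistent sets, some non-principal n-type of T_λ contains p and ¬⋀p for some p, so no model B_λ could realize every non-principal n-type. -}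

module Defs where

open import Data.Bool using (Bool; if_then_else_)
open import Data.Empty using (⊥)
open import Data.Fin using (Fin; zero; suc; toℕ)
open import Data.List using (List; []; _∷_)
open import Data.List.Membership.Propositional using () renaming (_∈_ to _∈ˡ_)
open import Data.List.Relation.Unary.All using (All)
open import Data.Nat using (ℕ; zero; suc; _+_; _*_; _^_)
import Data.List as List
import Data.Nat as ℕ
open import Data.Product using (Σ; ∃; ∃-syntax; _×_; _,_)
open import Data.Sum using (_⊎_)
open import Data.Unit using (⊤)
open import Data.Vec using (Vec; []; _∷_; lookup; toList)
import Data.Vec as Vec
import Data.Vec.Relation.Unary.All as VecAll
open import Function.Bundles using (_⇔_; _↔_; _↣_; module Inverse; module Injection)
open import Level using (Level; 0ℓ)
open import Relation.Binary.PropositionalEquality using (_≡_)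
open import Relation.Nullary using (¬_)
open import Relation.Unary using (Pred; _⊆_; _≐_; _∪_; ｛_｝; ∅)

1ℓ : Level
1ℓ = Level.suc 0ℓ

-- lub⁺ f is the least ordinal strictly above every f n, so every
-- countable ordinal has a notation; notations are compared with _≃_.
data Ord : Set where
  zero : Ord
  lub⁺ : (ℕ → Ord) → Ord

infix 4 _≤_ _<_ _≃_

mutual
  _≤_ : Ord → Ord → Set
  zero   ≤ β = ⊤
  lub⁺ f ≤ β = ∀ n → f n < β

  _<_ : Ord → Ord → Set
  α < zero   = ⊥
  α < lub⁺ g = ∃[ n ] α ≤ g n

_≃_ : Ord → Ord → Set
α ≃ β = α ≤ β × β ≤ α

sucᵒ : Ord → Ord
sucᵒ α = lub⁺ (λ _ → α)

finᵒ : ℕ → Ord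
finᵒ zero    = zero
finᵒ (suc n) = sucᵒ (finᵒ n)

ω : Ord
ω = lub⁺ finᵒ

IsLimit : Ord → Set
IsLimit δ = zero < δ × (∀ α → α < δ → sucᵒ α < δ)

IsLeast : ∀ {ℓ} → Pred Ord ℓ → Pred Ord ℓ
IsLeast P β = P β × (∀ γ → P γ → β ≤ γ)

record IsClub (C : Pred Ord 0ℓ) : Set where
  field
    resp      : ∀ α β → α ≃ β → C α → C β
    closed    : ∀ δ → IsLimit δ → (∀ α → α < δ → ∃[ β ] (α < β × β < δ × C β)) → C δ
    unbounded : ∀ α → ∃[ β ] (α < β × C β)

-- A countable vocabulary, with the numbering of its symbols that is used
-- to code diagrams by reals and formulas by hereditarily countable sets.
record Vocabulary : Set₁ where
  field
    RSym FSym : Set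
    arᴿ : RSym → ℕ
    arᶠ : FSym → ℕ
    #ᴿ  : RSym ↣ ℕ
    #ᶠ  : FSym ↣ ℕ

open Vocabulary

record Structure (V : Vocabulary) : Set₁ where
  field
    ∣_∣       : Set
    point     : ∣_∣
    countable : ∣_∣ ↣ ℕ
    relᴵ      : (r : RSym V) → Pred (Vec ∣_∣ (arᴿ V r)) 0ℓ
    funᴵ      : (f : FSym V) → Vec ∣_∣ (arᶠ V f) → ∣_∣

open Structure public using (∣_∣; relᴵ; funᴵ)

record _≅_ {V : Vocabulary} (M N : Structure V) : Set where
  field
    bijection : ∣ M ∣ ↔ ∣ N ∣
  open Inverse bijection public using (to)
  field
    pres-rel : ∀ r as → relᴵ M r as ⇔ relᴵ N r (Vec.map to as)
    pres-fun : ∀ f as → to (funᴵ M f as) ≡ funᴵ N f (Vec.map to as)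

infix 4 _≅_

data Term (V : Vocabulary) (n : ℕ) : Set where
  var : Fin n → Term V n
  fun : (f : FSym V) → Vec (Term V n) (arᶠ V f) → Term V n

-- Formula V n: formulas with free variables among v₀,…,vₙ₋₁ (de Bruijn).
-- ⋁′ is the only primitive infinitary connective and ⋀′ F is ¬⋁¬F; thus
-- the clause on ⋁ in ω-completeness below also governs ¬⋀.
data Formula (V : Vocabulary) : ℕ → Set where
  rel  : ∀ {n} (r : RSym V) → Vec (Term V n) (arᴿ V r) → Formula V n
  _≐′_ : ∀ {n} → Term V n → Term V n → Formula V n
  ¬′_  : ∀ {n} → Formula V n → Formula V n
  _∧′_ : ∀ {n} → Formula V n → Formula V n → Formula V n
  ∃′_  : ∀ {n} → Formula V (suc n) → Formula V n
  ⋁′   : ∀ {n} → (ℕ → Formula V n) → Formula V n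

infix  9 _≐′_
infix  8 ¬′_ ∃′_
infixr 7 _∧′_

Sentence : Vocabulary → Set
Sentence V = Formula V 0

module _ {V : Vocabulary} where

  infix  8 ∀′_
  infixr 6 _∨′_
  infixr 5 _⇒′_

  _∨′_ _⇒′_ : ∀ {n} → Formula V n → Formula V n → Formula V n
  φ ∨′ ψ = ¬′ (¬′ φ ∧′ ¬′ ψ)
  φ ⇒′ ψ = ¬′ (φ ∧′ ¬′ ψ)

  ∀′_ : ∀ {n} → Formula V (suc n) → Formula V n
  ∀′ φ = ¬′ (∃′ (¬′ φ))

  ⋀′ : ∀ {n} → (ℕ → Formula V n) → Formula V n
  ⋀′ F = ¬′ (⋁′ (λ i → ¬′ (F i)))

  ∃^ ∀^ : ∀ {n} k → Formula V (k + n) → Formula V n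
  ∃^ zero    φ = φ
  ∃^ (suc k) φ = ∃^ k (∃′ φ)
  ∀^ zero    φ = φ
  ∀^ (suc k) φ = ∀^ k (∀′ φ)

  ∃⋆ ∀⋆ : ∀ {n} → Formula V n → Sentence V
  ∃⋆ {zero}  φ = φ
  ∃⋆ {suc n} φ = ∃⋆ (∃′ φ)
  ∀⋆ {zero}  φ = φ
  ∀⋆ {suc n} φ = ∀⋆ (∀′ φ)

  mutual
    _[_]ᵗ : ∀ {m n} → Term V n → Vec (Term V m) n → Term V m
    var i    [ σ ]ᵗ = lookup σ i
    fun f ts [ σ ]ᵗ = fun f (ts [ σ ]ᵗˢ)

    _[_]ᵗˢ : ∀ {m n k} → Vec (Term V n) k → Vec (Term V m) n → Vec (Term V m) k
    []       [ σ ]ᵗˢ = []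
    (t ∷ ts) [ σ ]ᵗˢ = t [ σ ]ᵗ ∷ ts [ σ ]ᵗˢ

  idˢ : ∀ {n} → Vec (Term V n) n
  idˢ = Vec.tabulate var

  wkˢ : ∀ {n} → Vec (Term V (suc n)) n
  wkˢ = Vec.tabulate (λ i → var (suc i))

  _[_] : ∀ {m n} → Formula V n → Vec (Term V m) n → Formula V m
  rel r ts [ σ ] = rel r (ts [ σ ]ᵗˢ)
  (t ≐′ s) [ σ ] = (t [ σ ]ᵗ) ≐′ (s [ σ ]ᵗ)
  (¬′ φ)   [ σ ] = ¬′ (φ [ σ ])
  (φ ∧′ ψ) [ σ ] = (φ [ σ ]) ∧′ (ψ [ σ ])
  (∃′ φ)   [ σ ] = ∃′ (φ [ var zero ∷ (σ [ wkˢ ]ᵗˢ) ])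
  ⋁′ F     [ σ ] = ⋁′ (λ i → F i [ σ ])

  wk : ∀ {n} → Formula V n → Formula V (suc n)
  wk φ = φ [ wkˢ ]

  -- Identity of formulas when ⋁ is applied to a countable set of formulas
  -- rather than to an enumeration of it.
  data _≈_ : ∀ {n} → Formula V n → Formula V n → Set where
    rel : ∀ {n} {r} {ts : Vec (Term V n) _} → rel r ts ≈ rel r ts
    eq  : ∀ {n} {t s : Term V n} → (t ≐′ s) ≈ (t ≐′ s)
    neg : ∀ {n} {φ ψ : Formula V n} → φ ≈ ψ → (¬′ φ) ≈ (¬′ ψ)
    and : ∀ {n} {φ ψ φ₁ ψ₁ : Formula V n} → φ ≈ φ₁ → ψ ≈ ψ₁ → (φ ∧′ ψ) ≈ (φ₁ ∧′ ψ₁)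
    ex  : ∀ {n} {φ ψ : Formula V (suc n)} → φ ≈ ψ → (∃′ φ) ≈ (∃′ ψ)
    or  : ∀ {n} {F G : ℕ → Formula V n} →
          (∀ i → ∃[ j ] F i ≈ G j) → (∀ j → ∃[ i ] F i ≈ G j) → ⋁′ F ≈ ⋁′ G

  infix 4 _≈_

  Range : ∀ {n} → (ℕ → Formula V n) → Pred (Formula V n) 0ℓ
  Range F φ = ∃[ i ] φ ≈ F i

  module _ (M : Structure V) where
    mutual
      eval : ∀ {n} → Term V n → Vec ∣ M ∣ n → ∣ M ∣
      eval (var i)    ρ = lookup ρ i
      eval (fun f ts) ρ = funᴵ M f (evals ts ρ)

      evals : ∀ {n k} → Vec (Term V n) k → Vec ∣ M ∣ n → Vec ∣ M ∣ k
      evals []       ρ = []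
      evals (t ∷ ts) ρ = eval t ρ ∷ evals ts ρ

  _⊨_⟨_⟩ : ∀ (M : Structure V) {n} → Formula V n → Vec ∣ M ∣ n → Set
  M ⊨ rel r ts ⟨ ρ ⟩ = relᴵ M r (evals M ts ρ)
  M ⊨ t ≐′ s   ⟨ ρ ⟩ = eval M t ρ ≡ eval M s ρ
  M ⊨ ¬′ φ     ⟨ ρ ⟩ = ¬ (M ⊨ φ ⟨ ρ ⟩)
  M ⊨ φ ∧′ ψ   ⟨ ρ ⟩ = M ⊨ φ ⟨ ρ ⟩ × M ⊨ ψ ⟨ ρ ⟩
  M ⊨ ∃′ φ     ⟨ ρ ⟩ = ∃[ a ] M ⊨ φ ⟨ a ∷ ρ ⟩
  M ⊨ ⋁′ F     ⟨ ρ ⟩ = ∃[ i ] M ⊨ F i ⟨ ρ ⟩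

  infix 4 _⊨_⟨_⟩ _⊨_ _⊨ᵀ_

  _⊨_ : Structure V → Sentence V → Set
  M ⊨ φ = M ⊨ φ ⟨ [] ⟩

  _⊨ᵀ_ : Structure V → Pred (Sentence V) 0ℓ → Set
  M ⊨ᵀ S = ∀ φ → S φ → M ⊨ φ

  RealizedBy : ∀ (M : Structure V) {n} → Pred (Formula V n) 0ℓ → Vec ∣ M ∣ n → Set
  RealizedBy M p a = ∀ φ → p φ → M ⊨ φ ⟨ a ⟩

  Realizes : ∀ (M : Structure V) {n} → Pred (Formula V n) 0ℓ → Set
  Realizes M p = ∃[ a ] RealizedBy M p a

  Valid : Sentence V → Set₁
  Valid φ = ∀ M → M ⊨ φ

  Equivalent : Sentence V → Sentence V → Set₁
  Equivalent φ ψ = ∀ M → M ⊨ φ ⇔ M ⊨ ψ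

  data QF {n : ℕ} : Formula V n → Set where
    rel : ∀ {r ts} → QF (rel r ts)
    eq  : ∀ {t s} → QF (t ≐′ s)
    neg : ∀ {φ} → QF φ → QF (¬′ φ)
    and : ∀ {φ ψ} → QF φ → QF ψ → QF (φ ∧′ ψ)

  mutual
    data Σⁱⁿ : ∀ {n} → Ord → Formula V n → Set where
      qf : ∀ {n} {φ : Formula V n} → QF φ → Σⁱⁿ zero φ
      or : ∀ {n α} {F : ℕ → Formula V n} → zero < α → (∀ i → ∃Π α (F i)) → Σⁱⁿ α (⋁′ F)

    data Πⁱⁿ : ∀ {n} → Ord → Formula V n → Set where
      qf  : ∀ {n} {φ : Formula V n} → QF φ → Πⁱⁿ zero φ
      and : ∀ {n α} {F : ℕ → Formula V n} → zero < α → (∀ i → ∀Σ α (F i)) → Πⁱⁿ α (⋀′ F)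

    data ∃Π : ∀ {n} → Ord → Formula V n → Set where
      ex : ∀ {n α β} k {ψ : Formula V (k + n)} → β < α → Πⁱⁿ β ψ → ∃Π α (∃^ k ψ)

    data ∀Σ : ∀ {n} → Ord → Formula V n → Set where
      all : ∀ {n α β} k {ψ : Formula V (k + n)} → β < α → Σⁱⁿ β ψ → ∀Σ α (∀^ k ψ)

  _≡[_]_ : Structure V → Ord → Structure V → Set
  M ≡[ α ] N = ∀ (ψ : Sentence V) → Πⁱⁿ α ψ → M ⊨ ψ ⇔ N ⊨ ψ

  IsScottSentence : Structure V → Sentence V → Set₁
  IsScottSentence M ψ = ∀ N → N ⊨ ψ ⇔ N ≅ M

  -- "cSR M α" is the relation cSR(M) = α; likewise for the other ranks.
  cSR : Structure V → Ord → Set₁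
  cSR M = IsLeast (λ α → ∃[ ψ ] (Πⁱⁿ (sucᵒ α) ψ × IsScottSentence M ψ))

  -- A sentence counts as Π_β or Σ_β if it is equivalent to one.
  qr : Sentence V → Ord → Set₁
  qr φ = IsLeast (λ β → ∃[ ψ ] (Equivalent φ ψ × (Πⁱⁿ β ψ ⊎ Σⁱⁿ β ψ)))

  CountablyManyModels : ∀ {ℓ} → Pred (Structure V) ℓ → Set (1ℓ Level.⊔ ℓ)
  CountablyManyModels P = Σ (ℕ → Structure V) λ e → ∀ M → P M → ∃[ i ] M ≅ e i

  𝒞 : Sentence V → Ord → Structure V → Set₁
  𝒞 φ β M = M ⊨ φ × ¬ CountablyManyModels (λ N → N ⊨ φ × N ≡[ β ] M)

  record MinimalCounterexample (φ : Sentence V) : Set₁ where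
    field
      ℵ₁-many : Σ (Ord → Structure V) λ e →
                (∀ α → e α ⊨ φ) ×
                (∀ α β → e α ≅ e β ⇔ α ≃ β) ×
                (∀ M → M ⊨ φ → ∃[ α ] M ≅ e α)
      scattered : ∀ α → Σ (ℕ → Structure V) λ e → ∀ M → M ⊨ φ → ∃[ i ] M ≡[ α ] e i
      minimal : ∀ ψ → CountablyManyModels (_⊨ (φ ∧′ ψ)) ⊎ CountablyManyModels (_⊨ (φ ∧′ ¬′ ψ))
      Σ-types : ∀ α n → Σ (ℕ → Σ (Structure V) λ N → Vec ∣ N ∣ n) λ e →
                ∀ M → M ⊨ φ → ∀ (a : Vec ∣ M ∣ n) → ∃[ i ] (let (N , b) = e i in
                ∀ (ψ : Formula V n) → Σⁱⁿ α ψ → M ⊨ ψ ⟨ a ⟩ ⇔ N ⊨ ψ ⟨ b ⟩)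
      unique-uncountable : ∀ β → ∃ (𝒞 φ β) × (∀ M N → 𝒞 φ β M → 𝒞 φ β N → M ≡[ β ] N)

  f[_] : Sentence V → Ord → Ord → Set₁
  f[ φ ] α = IsLeast (λ β → ∀ M → M ⊨ φ → ¬ 𝒞 φ α M → ∃[ γ ] (cSR M γ × γ < β))

  𝔉 : Sentence V → Pred Ord 1ℓ
  𝔉 φ α = ∃[ β ] (f[ φ ] α β × β ≤ α)

Class : Vocabulary → Set₁
Class V = ∀ n → Pred (Formula V n) 0ℓ

module _ {V : Vocabulary} where

  _⊑ᶜ_ _≐ᶜ_ : Class V → Class V → Set
  L ⊑ᶜ L′ = ∀ n → L n ⊆ L′ n
  L ≐ᶜ L′ = ∀ n → L n ≐ L′ n

  _∪ᶜ_ : Class V → Class V → Class V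
  (L ∪ᶜ L′) n = L n ∪ L′ n

  -- The least class containing X and satisfying the closure conditions for
  -- fragments.  Every fragment contains the atomic formulas.
  data Gen (X : Class V) : Class V where
    base  : ∀ {n φ} → X n φ → Gen X n φ
    resp  : ∀ {n φ ψ} → φ ≈ ψ → Gen X n φ → Gen X n ψ
    rel   : ∀ {n} r ts → Gen X n (rel r ts)
    eq    : ∀ {n} t s → Gen X n (t ≐′ s)
    neg   : ∀ {n φ} → Gen X n φ → Gen X n (¬′ φ)
    and   : ∀ {n φ ψ} → Gen X n φ → Gen X n ψ → Gen X n (φ ∧′ ψ)
    ex    : ∀ {n φ} → Gen X (suc n) φ → Gen X n (∃′ φ)
    subst : ∀ {m n φ} (σ : Vec (Term V m) n) → Gen X n φ → Gen X m (φ [ σ ])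
    neg⁻¹ : ∀ {n φ} → Gen X n (¬′ φ) → Gen X n φ
    and₁  : ∀ {n φ ψ} → Gen X n (φ ∧′ ψ) → Gen X n φ
    and₂  : ∀ {n φ ψ} → Gen X n (φ ∧′ ψ) → Gen X n ψ
    ex⁻¹  : ∀ {n φ} → Gen X n (∃′ φ) → Gen X (suc n) φ
    or⁻¹  : ∀ {n F} → Gen X n (⋁′ F) → ∀ i → Gen X n (F i)

  CountableClass : Class V → Set
  CountableClass L = ∀ n → Σ (ℕ → Formula V n) λ e → L n ⊆ Range e

  IsFragment : Class V → Set
  IsFragment L = Gen L ⊑ᶜ L × CountableClass L

  Finitary : Class V
  Finitary = Gen (λ _ → ∅)

  -- Classical natural deduction.  Every rule has finitely many premises; in
  -- particular there is no elimination rule for ⋁ (introduction for ⋀).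
  infix 3 _⊢_
  data _⊢_ : ∀ {n} → List (Formula V n) → Formula V n → Set where
    hyp   : ∀ {n Γ} {φ : Formula V n} → φ ∈ˡ Γ → Γ ⊢ φ
    conv  : ∀ {n Γ} {φ ψ : Formula V n} → φ ≈ ψ → Γ ⊢ φ → Γ ⊢ ψ
    ∧I    : ∀ {n Γ} {φ ψ : Formula V n} → Γ ⊢ φ → Γ ⊢ ψ → Γ ⊢ φ ∧′ ψ
    ∧E₁   : ∀ {n Γ} {φ ψ : Formula V n} → Γ ⊢ φ ∧′ ψ → Γ ⊢ φ
    ∧E₂   : ∀ {n Γ} {φ ψ : Formula V n} → Γ ⊢ φ ∧′ ψ → Γ ⊢ ψ
    ¬I    : ∀ {n Γ} {φ ψ : Formula V n} → φ ∷ Γ ⊢ ψ → φ ∷ Γ ⊢ ¬′ ψ → Γ ⊢ ¬′ φ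
    ¬E    : ∀ {n Γ} {φ ψ : Formula V n} → ¬′ φ ∷ Γ ⊢ ψ → ¬′ φ ∷ Γ ⊢ ¬′ ψ → Γ ⊢ φ
    ∃I    : ∀ {n Γ} {φ : Formula V (suc n)} t → Γ ⊢ φ [ t ∷ idˢ ] → Γ ⊢ ∃′ φ
    ∃E    : ∀ {n Γ} {φ : Formula V (suc n)} {ψ : Formula V n} →
            Γ ⊢ ∃′ φ → φ ∷ List.map wk Γ ⊢ wk ψ → Γ ⊢ ψ
    ⋁I    : ∀ {n Γ} {F : ℕ → Formula V n} i → Γ ⊢ F i → Γ ⊢ ⋁′ F
    refl  : ∀ {n} {Γ : List (Formula V n)} t → Γ ⊢ t ≐′ t
    repl  : ∀ {n Γ} (φ : Formula V (suc n)) {t s} →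
            Γ ⊢ t ≐′ s → Γ ⊢ φ [ t ∷ idˢ ] → Γ ⊢ φ [ s ∷ idˢ ]
    point : ∀ {n} {Γ : List (Formula V n)} → Γ ⊢ ∃′ (var zero ≐′ var zero)

  -- The free variables v₀,…,vₙ₋₁ of the formulas in H are treated as
  -- constants.
  FinitarilyConsistent : ∀ {n} → Pred (Formula V n) 0ℓ → Set
  FinitarilyConsistent H = ∀ Γ → All H Γ → ∀ ψ → ¬ (Γ ⊢ ψ ∧′ ¬′ ψ)

  -- For a complete theory S.
  Principal : Pred (Sentence V) 0ℓ → ∀ {n} → Pred (Formula V n) 0ℓ → Set
  Principal S p = ∃[ G ] (p G × (∀ F → p F → S (∀⋆ (G ⇒′ F))))

  Th : Class V → Structure V → Pred (Sentence V) 0ℓ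
  Th L A φ = L 0 φ × A ⊨ φ

  tp : Class V → (A : Structure V) → ∀ {n} → Vec ∣ A ∣ n → Pred (Formula V n) 0ℓ
  tp L A a φ = L _ φ × A ⊨ φ ⟨ a ⟩

  IsAtomicModel : Class V → Pred (Sentence V) 0ℓ → Structure V → Set
  IsAtomicModel L S A = A ⊨ᵀ S × (∀ {n} (a : Vec ∣ A ∣ n) → Principal S (tp L A a))

  -- ⋀ p, for p a non-principal complete L-type realized in A; p is given by
  -- an enumeration F.
  RealizedConj : Class V → Structure V → Class V
  RealizedConj L A n φ = ∃[ F ] (φ ≡ ⋀′ F ×
    (Σ (Vec ∣ A ∣ n) λ a → Range F ≐ tp L A a) × ¬ Principal (Th L A) (Range F))

  -- As lub⁺ f = sup (f n + 1), the second clause covers successors (where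
  -- it is the step from L_δ to L_{δ+1}) and limits (where it is the union).
  L[_] : Structure V → Ord → Class V
  L[ A ] zero         = Finitary
  L[ A ] (lub⁺ f) n φ = ∃[ k ] Gen (L[ A ] (f k) ∪ᶜ RealizedConj (L[ A ] (f k)) A) n φ

  srSacks : Structure V → Ord → Set
  srSacks A = IsLeast (λ δ → IsAtomicModel (L[ A ] δ) (Th (L[ A ] δ) A) A)

record Node (V : Vocabulary) : Set₁ where
  field
    Lang : Class V
    Thy  : Pred (Sentence V) 0ℓ

open Node public

module _ {V : Vocabulary} where

  infix 4 _⊑_

  _⊑_ : Node V → Node V → Set
  N ⊑ N′ = Lang N ⊑ᶜ Lang N′ × Thy N ⊆ Thy N′

  record IsωComplete (N : Node V) : Set where
    field
      fragment   : IsFragment (Lang N)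
      inLang     : Thy N ⊆ Lang N 0
      complete   : ∀ φ → Lang N 0 φ → Thy N φ ⊎ Thy N (¬′ φ)
      ω-complete : ∀ F → Thy N (⋁′ F) → ∃[ i ] Thy N (F i)
      consistent : FinitarilyConsistent (Thy N)

  _↑_ : Pred (Sentence V) 0ℓ → ∀ n → Pred (Formula V n) 0ℓ
  (S ↑ n) ψ = ∃[ φ ] (S φ × ψ ≡ φ [ [] ])

  -- Types, like the theories of the tree, are ω-complete: an n-type of N is
  -- a complete theory extending N in the language with n new constants.
  -- Were this dropped, compactness would yield, for each non-principal type
  -- p of a lower node, "types" containing p and ¬⋀p, which nothing realizes.
  record IsType (N : Node V) {n : ℕ} (p : Pred (Formula V n) 0ℓ) : Set where
    field
      inLang     : p ⊆ Lang N n
      consistent : FinitarilyConsistent ((Thy N ↑ n) ∪ p)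
      maximal    : ∀ φ → Lang N n φ →
                   FinitarilyConsistent ((Thy N ↑ n) ∪ (p ∪ ｛ φ ｝)) → p φ
      ω-complete : ∀ F → p (⋁′ F) → ∃[ i ] p (F i)

  TypeConj : Node V → Class V
  TypeConj N n φ = ∃[ F ] (φ ≡ ⋀′ F × IsType N (Range F) × ¬ Principal (Thy N) (Range F))

  Lang′ : Node V → Class V
  Lang′ N = Gen (Lang N ∪ᶜ TypeConj N)

  IsChild : Node V → Node V → Set
  IsChild N N′ = Lang N′ ≐ᶜ Lang′ N × Thy N ⊆ Thy N′ × IsωComplete N′

  module _ (φ : Sentence V) where

    data ⟨φ⟩ : Class V where
      sentence : ⟨φ⟩ 0 φ

    L₀ : Class V
    L₀ = Gen ⟨φ⟩

    -- A tautology is a logically valid sentence.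
    BaseTheory : Pred (Sentence V) 1ℓ
    BaseTheory ψ = ψ ≈ φ ⊎ (L₀ 0 ψ × Valid ψ)

    data IsNode : Ord → Node V → Set₁ where
      root  : ∀ {N} → Lang N ≐ᶜ L₀ → BaseTheory ⊆ Thy N → IsωComplete N → IsNode zero N
      child : ∀ {δ δ′ N N′} → δ′ ≃ sucᵒ δ → IsNode δ N → IsChild N N′ → IsNode δ′ N′
      limit : ∀ {δ N} (chain : Ord → Node V) → IsLimit δ →
              (∀ α → α < δ → IsNode α (chain α)) →
              (∀ α β → α ≤ β → β < δ → chain α ⊑ chain β) →
              (∀ n ψ → Lang N n ψ ⇔ (∃[ α ] (α < δ × Lang (chain α) n ψ))) →
              (∀ ψ → Thy N ψ ⇔ (∃[ α ] (α < δ × Thy (chain α) ψ))) →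
              IsNode δ N

data Code : ℕ → Set where
  zer  : Code 0
  succ : Code 1
  proj : ∀ {k} → Fin k → Code k
  orc  : Code 1
  comp : ∀ {k m} → Code m → Vec (Code k) m → Code k
  prec : ∀ {k} → Code k → Code (2 + k) → Code (suc k)
  mu   : ∀ {k} → Code (suc k) → Code k

data _∣_⟨_⟩⇓_ (X : ℕ → Bool) : ∀ {k} → Code k → Vec ℕ k → ℕ → Set where
  zer   : X ∣ zer ⟨ [] ⟩⇓ 0
  succ  : ∀ {x} → X ∣ succ ⟨ x ∷ [] ⟩⇓ suc x
  proj  : ∀ {k} {i : Fin k} {xs} → X ∣ proj i ⟨ xs ⟩⇓ lookup xs i
  orc   : ∀ {x} → X ∣ orc ⟨ x ∷ [] ⟩⇓ (if X x then 1 else 0)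
  comp  : ∀ {k m} {c : Code m} {cs : Vec (Code k) m} {xs ys z} →
          (∀ i → X ∣ lookup cs i ⟨ xs ⟩⇓ lookup ys i) → X ∣ c ⟨ ys ⟩⇓ z →
          X ∣ comp c cs ⟨ xs ⟩⇓ z
  prec₀ : ∀ {k} {c : Code k} {d xs z} → X ∣ c ⟨ xs ⟩⇓ z → X ∣ prec c d ⟨ 0 ∷ xs ⟩⇓ z
  precₛ : ∀ {k} {c : Code k} {d x xs y z} → X ∣ prec c d ⟨ x ∷ xs ⟩⇓ y →
          X ∣ d ⟨ x ∷ y ∷ xs ⟩⇓ z → X ∣ prec c d ⟨ suc x ∷ xs ⟩⇓ z
  mu    : ∀ {k} {c : Code (suc k)} {xs y} → X ∣ c ⟨ y ∷ xs ⟩⇓ 0 →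
          (∀ z → z ℕ.< y → ∃[ w ] X ∣ c ⟨ z ∷ xs ⟩⇓ suc w) → X ∣ mu c ⟨ xs ⟩⇓ y

Decides : (ℕ → Bool) → ∀ {k} → Pred (Vec ℕ k) 0ℓ → Set
Decides X P = ∃[ c ] (∀ xs → (P xs → X ∣ c ⟨ xs ⟩⇓ 1) × (¬ P xs → X ∣ c ⟨ xs ⟩⇓ 0))

-- X computes a linear order R (reflexive on its field, a subset of ℕ) that
-- h maps isomorphically onto the ordinals below α.
HasCopyOf : (ℕ → Bool) → Ord → Set₁
HasCopyOf X α = Σ (Pred (Vec ℕ 2) 0ℓ) λ R → Σ (ℕ → Ord) λ h →
  let Field = λ x → R (x ∷ x ∷ []) in
  Decides X R ×
  (∀ x y → R (x ∷ y ∷ []) ⇔ (Field x × Field y × h x ≤ h y)) ×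
  (∀ x y → Field x → Field y → h x ≃ h y → x ≡ y) ×
  (∀ x → Field x → h x < α) ×
  (∀ β → β < α → ∃[ x ] (Field x × h x ≃ β))

ω₁^ : (ℕ → Bool) → Ord → Set₁
ω₁^ X = IsLeast (λ α → ¬ HasCopyOf X α)

encode : List ℕ → ℕ
encode []       = 0
encode (x ∷ xs) = 2 ^ x * suc (2 * encode xs)

module _ {V : Vocabulary} where

  open Injection using () renaming (to to apply)

  -- The diagram of the copy of M with universe e[M] ⊆ ℕ.
  data Diagram (M : Structure V) (e : ∣ M ∣ → ℕ) : Pred (Vec ℕ 1) 0ℓ where
    elem : ∀ a → Diagram M e (encode (0 ∷ e a ∷ []) ∷ [])
    rel  : ∀ r as → relᴵ M r as →
           Diagram M e (encode (1 ∷ apply (#ᴿ V) r ∷ toList (Vec.map e as)) ∷ [])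
    fun  : ∀ f as →
           Diagram M e (encode (2 ∷ apply (#ᶠ V) f ∷ e (funᴵ M f as) ∷ toList (Vec.map e as)) ∷ [])

  ComputesCopy : (ℕ → Bool) → Structure V → Set
  ComputesCopy X M = Σ (∣ M ∣ ↣ ℕ) λ e → Decides X (Diagram M (apply e))

  ω₁[_] : Structure V → Ord → Set₁
  ω₁[ M ] = IsLeast (λ α → ∃[ X ] (ComputesCopy X M × ω₁^ X α))

data HC : Set where
  ∅ʰ  : HC
  set : (ℕ → HC) → HC

infix 4 _≈ʰ_ _∈ʰ_

_≈ʰ_ : HC → HC → Set
∅ʰ    ≈ʰ ∅ʰ    = ⊤
∅ʰ    ≈ʰ set g = ⊥
set f ≈ʰ ∅ʰ    = ⊥
set f ≈ʰ set g = (∀ i → ∃[ j ] f i ≈ʰ g j) × (∀ j → ∃[ i ] f i ≈ʰ g j)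

_∈ʰ_ : HC → HC → Set
x ∈ʰ ∅ʰ    = ⊥
x ∈ʰ set f = ∃[ i ] x ≈ʰ f i

data SetFormula : ℕ → Set where
  _∈′_ _≐′_ : ∀ {n} → Fin n → Fin n → SetFormula n
  ¬′_  : ∀ {n} → SetFormula n → SetFormula n
  _∧′_ : ∀ {n} → SetFormula n → SetFormula n → SetFormula n
  ∃′_  : ∀ {n} → SetFormula (suc n) → SetFormula n

SatIn : Pred HC 0ℓ → ∀ {n} → SetFormula n → Vec HC n → Set
SatIn A (i ∈′ j) ρ = lookup ρ i ∈ʰ lookup ρ j
SatIn A (i ≐′ j) ρ = lookup ρ i ≈ʰ lookup ρ j
SatIn A (¬′ φ)   ρ = ¬ SatIn A φ ρ
SatIn A (φ ∧′ ψ) ρ = SatIn A φ ρ × SatIn A ψ ρ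
SatIn A (∃′ φ)   ρ = ∃[ x ] (A x × SatIn A φ (x ∷ ρ))

data IsΔ₀ : ∀ {n} → SetFormula n → Set where
  mem : ∀ {n} {i j : Fin n} → IsΔ₀ (i ∈′ j)
  eq  : ∀ {n} {i j : Fin n} → IsΔ₀ (i ≐′ j)
  neg : ∀ {n} {φ : SetFormula n} → IsΔ₀ φ → IsΔ₀ (¬′ φ)
  and : ∀ {n} {φ ψ : SetFormula n} → IsΔ₀ φ → IsΔ₀ ψ → IsΔ₀ (φ ∧′ ψ)
  bex : ∀ {n} {i : Fin n} {φ : SetFormula (suc n)} → IsΔ₀ φ → IsΔ₀ (∃′ ((zero ∈′ suc i) ∧′ φ))

data IsΣ₁ : ∀ {n} → SetFormula n → Set where
  Δ₀ : ∀ {n} {φ : SetFormula n} → IsΔ₀ φ → IsΣ₁ φ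
  ex : ∀ {n} {φ : SetFormula (suc n)} → IsΣ₁ φ → IsΣ₁ (∃′ φ)

data IsΠ₁ : ∀ {n} → SetFormula n → Set where
  Δ₀  : ∀ {n} {φ : SetFormula n} → IsΔ₀ φ → IsΠ₁ φ
  all : ∀ {n} {φ : SetFormula (suc n)} → IsΠ₁ φ → IsΠ₁ (¬′ (∃′ (¬′ φ)))

IsΔ₁Over : Pred HC 0ℓ → (HC → HC → Set) → Set
IsΔ₁Over A R = ∃[ m ] Σ (Vec HC m) λ ρ → VecAll.All A ρ ×
  ∃[ σ ] ∃[ π ] (IsΣ₁ σ × IsΠ₁ π ×
    (∀ x y → A x → A y → (R x y ⇔ SatIn A σ (x ∷ y ∷ ρ)) × (R x y ⇔ SatIn A π (x ∷ y ∷ ρ))))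

Def : Pred HC 0ℓ → Pred HC 0ℓ
Def A x = (∀ y → y ∈ʰ x → A y) × (∃[ n ] Σ (Vec HC n) λ ρ → VecAll.All A ρ ×
  ∃[ ψ ] (∀ y → A y → y ∈ʰ x ⇔ SatIn A ψ (y ∷ ρ)))

data TC (t : HC) : Pred HC 0ℓ where
  here : ∀ {x} → x ≈ʰ t → TC t x
  step : ∀ {x y} → TC t y → x ∈ʰ y → TC t x

-- As for L[ A ], the second clause covers both successors and limits.
L⟨_,_⟩ : Ord → HC → Pred HC 0ℓ
L⟨ zero   , t ⟩   = TC t
L⟨ lub⁺ f , t ⟩ x = ∃[ n ] Def L⟨ f n , t ⟩ x

L⟨ω₁,_⟩ : HC → Pred HC 0ℓ
L⟨ω₁, t ⟩ x = ∃[ α ] L⟨ α , t ⟩ x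

-- Kripke–Platek set theory; foundation holds because ∈ʰ is well founded.
record IsAdmissible (A : Pred HC 0ℓ) : Set where
  field
    inhabited  : ∃ A
    transitive : ∀ x y → A x → y ∈ʰ x → A y
    pairing    : ∀ x y → A x → A y → ∃[ z ] (A z × x ∈ʰ z × y ∈ʰ z)
    union      : ∀ x → A x → ∃[ z ] (A z × (∀ y w → y ∈ʰ x → w ∈ʰ y → w ∈ʰ z))
    separation : ∀ {n} (ψ : SetFormula (suc n)) ρ → IsΔ₀ ψ → VecAll.All A ρ → ∀ x → A x →
                 ∃[ z ] (A z × (∀ y → y ∈ʰ z ⇔ (y ∈ʰ x × SatIn A ψ (y ∷ ρ))))
    collection : ∀ {n} (ψ : SetFormula (2 + n)) ρ → IsΔ₀ ψ → VecAll.All A ρ → ∀ x → A x →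
                 (∀ y → y ∈ʰ x → ∃[ w ] (A w × SatIn A ψ (w ∷ y ∷ ρ))) →
                 ∃[ z ] (A z × (∀ y → y ∈ʰ x → ∃[ w ] (w ∈ʰ z × SatIn A ψ (w ∷ y ∷ ρ))))

-- Membership in the von Neumann ordinal α.
_∈ᵒ_ : HC → Ord → Set
y ∈ᵒ zero   = ⊥
y ∈ᵒ lub⁺ f = ∃[ n ] (y ∈ᵒ f n ⊎ (∀ z → z ∈ʰ y ⇔ z ∈ᵒ f n))

IsOrdinal : HC → Ord → Set
IsOrdinal x α = ∀ z → z ∈ʰ x ⇔ z ∈ᵒ α

upairʰ : HC → HC → HC
upairʰ x y = set elements
  where
  elements : ℕ → HC
  elements zero    = x
  elements (suc _) = y

pairʰ : HC → HC → HC
pairʰ x y = upairʰ (upairʰ x x) (upairʰ x y)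

numʰ : ℕ → HC
numʰ zero    = ∅ʰ
numʰ (suc n) = upairʰ (numʰ n) (numʰ n)

module _ {V : Vocabulary} where

  open Injection using () renaming (to to apply)

  mutual
    ⌜_⌝ᵗ : ∀ {n} → Term V n → HC
    ⌜ var i ⌝ᵗ    = pairʰ (numʰ 0) (numʰ (toℕ i))
    ⌜ fun f ts ⌝ᵗ = pairʰ (numʰ 1) (pairʰ (numʰ (apply (#ᶠ V) f)) ⌜ ts ⌝ᵗˢ)

    ⌜_⌝ᵗˢ : ∀ {n k} → Vec (Term V n) k → HC
    ⌜ [] ⌝ᵗˢ     = ∅ʰ
    ⌜ t ∷ ts ⌝ᵗˢ = pairʰ ⌜ t ⌝ᵗ ⌜ ts ⌝ᵗˢ

  ⌜_⌝ : ∀ {n} → Formula V n → HC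
  ⌜ rel r ts ⌝ = pairʰ (numʰ 0) (pairʰ (numʰ (apply (#ᴿ V) r)) ⌜ ts ⌝ᵗˢ)
  ⌜ t ≐′ s ⌝   = pairʰ (numʰ 1) (pairʰ ⌜ t ⌝ᵗ ⌜ s ⌝ᵗ)
  ⌜ ¬′ φ ⌝     = pairʰ (numʰ 2) ⌜ φ ⌝
  ⌜ φ ∧′ ψ ⌝   = pairʰ (numʰ 3) (pairʰ ⌜ φ ⌝ ⌜ ψ ⌝)
  ⌜ ∃′ φ ⌝     = pairʰ (numʰ 4) ⌜ φ ⌝
  ⌜ ⋁′ F ⌝     = pairʰ (numʰ 5) (set (λ i → ⌜ F i ⌝))

  IsCodeOf : ∀ {ℓ} → HC → Pred (Sentence V) ℓ → Set ℓ
  IsCodeOf x S = ∀ y → y ∈ʰ x ⇔ (∃[ φ ] (S φ × y ≈ʰ ⌜ φ ⌝))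

module _ {V : Vocabulary} where

  -- C is any club with the listed properties; how Sacks' hull construction
  -- produces one is not recorded.
  record SacksData (φ : Sentence V) : Set₁ where
    field
      t      : HC
      t-code : IsCodeOf t (BaseTheory φ)

      T            : Ord → Node V
      T-node       : ∀ δ → IsNode φ δ (T δ)
      T-increasing : ∀ α β → α ≤ β → T α ⊑ T β
      T-child      : ∀ δ → IsChild (T δ) (T (sucᵒ δ))
      T-limit-Lang : ∀ δ → IsLimit δ → ∀ n ψ → Lang (T δ) n ψ → ∃[ α ] (α < δ × Lang (T α) n ψ)
      T-limit-Thy  : ∀ δ → IsLimit δ → ∀ ψ → Thy (T δ) ψ → ∃[ α ] (α < δ × Thy (T α) ψ)
      T-code       : ∀ δ → ∃[ y ] (L⟨ω₁, t ⟩ y × IsCodeOf y (Thy (T δ)))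
      T-Δ₁         : IsΔ₁Over L⟨ω₁, t ⟩
                       (λ x y → ∃[ δ ] (IsOrdinal x δ × IsCodeOf y (Thy (T δ))))

      A              : Ord → Structure V
      A-atomic       : ∀ δ → IsAtomicModel (Lang (T δ)) (Thy (T δ)) (A δ)
      A-rank         : ∀ δ → srSacks (A δ) δ
      A-nonprincipal : ∀ δ → ∃[ n ] Σ (Pred (Formula V n) 0ℓ) λ p →
                       IsType (T δ) p × ¬ Principal (Thy (T δ)) p × Realizes (A (sucᵒ δ)) p

      C            : Pred Ord 0ℓ
      C-club       : IsClub C
      C->ω         : ∀ κ → C κ → ω < κ
      C-admissible : ∀ κ → C κ → IsAdmissible L⟨ κ , t ⟩

      B              : Ord → Structure V
      B-model        : ∀ κ → C κ → B κ ⊨ᵀ Thy (T κ)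
      B-nonprincipal : ∀ κ → C κ → ∀ n (p : Pred (Formula V n) 0ℓ) →
                       IsType (T κ) p → ¬ Principal (Thy (T κ)) p → Realizes (B κ) p
      B-ω₁           : ∀ κ → C κ → ω₁[ B κ ] κ
      B-rank         : ∀ κ → C κ → srSacks (B κ) (sucᵒ κ)

  module _ {φ : Sentence V} (D : SacksData φ) where
    open SacksData D

    S° : Pred Ord 1ℓ
    S° κ = 𝔉 φ κ × C κ × (∃[ β ] (qr φ β × β < κ))

    IsFiberModel : Ord → Structure V → Set₁
    IsFiberModel κ M = M ⊨ᵀ Thy (T κ) × ω₁[ M ] κ

  -- The choice of a is immaterial: in a fiber model at κ any two realizers of
  -- a type of T κ are automorphic.
  Φ : Ord → (M : Structure V) → ∀ {n} → Pred (Formula V n) 0ℓ → Pred (Formula V n) 0ℓ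
  Φ κ M q γ = Πⁱⁿ κ γ × (∃[ a ] (RealizedBy M q a × M ⊨ γ ⟨ a ⟩))

  Supports : Ord → (M : Structure V) → ∀ {n} → Pred (Formula V n) 0ℓ → Formula V n → Set
  Supports κ M Γ θ = Σⁱⁿ κ θ × M ⊨ ∃⋆ θ × (∀ γ → Γ γ → M ⊨ ∀⋆ (θ ⇒′ γ))

{-# OPTIONS --safe #-}

-- Over T_δ, the L_β-type of a tuple for β < δ is isolated by one formula of
-- L_δ: a generator if the type is principal, and its conjunction otherwise.
-- Hence every Σ_δ formula true of a tuple a (and the negation of every Π_δ
-- formula false of a) follows over T_δ from a formula of L_δ true of a.  So
-- tuples realizing the same L_κ-type, in whatever models of T_κ, have the same
-- Π_κ-type, and the existence of a tuple satisfying θ, or θ ∧ ¬γ, passes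
-- between any two models of T_κ because T_κ is complete.
module Submission where

open import Defs
open import Axiom.DoubleNegationElimination using (em⇒dne)
open import Axiom.ExcludedMiddle using (ExcludedMiddle)
open import Data.Fin using (Fin; zero; suc)
open import Data.List using (List; []; _∷_)
import Data.List as List
open import Data.List.Relation.Unary.All as All using (All; []; _∷_)
import Data.List.Relation.Unary.All.Properties as Allₚ
open import Data.List.Relation.Unary.Any using (here; there)
open import Data.Nat using (ℕ; zero; suc; _+_)
open import Data.Product using (∃; ∃-syntax; _×_; _,_; proj₁; proj₂)
import Data.Product as Product
open import Data.Product.Function.NonDependent.Propositional using (_×-⇔_)
open import Data.Sum using (_⊎_; inj₁; inj₂; [_,_])
import Data.Sum as Sum
open import Data.Vec using (Vec; []; _∷_; lookup; _++_; tabulate)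
open import Data.Vec.Properties using (tabulate∘lookup)
open import Function using (_∘_; id; _$_)
open import Function.Bundles using (_⇔_; mk⇔; module Equivalence)
open import Function.Construct.Composition using (_⇔-∘_)
open import Function.Properties.Equivalence using () renaming (sym to ⇔-sym; refl to ⇔-refl)
open import Level using (0ℓ)
open import Relation.Binary.PropositionalEquality
  using (_≡_; refl; sym; trans; cong; cong₂)
  renaming (subst to ≡-subst)
open import Relation.Nullary using (¬_; Dec; yes; no; contradiction)
open import Relation.Unary using (Pred; _⊆_; _≐_)

open Equivalence using (to; from)

-- Order on ordinal notations.

≤-refl : ∀ α → α ≤ α
≤-refl zero     = _
≤-refl (lub⁺ f) = λ n → n , ≤-refl (f n)

<⇒suc≤ : ∀ {α β} → α < β → sucᵒ α ≤ β
<⇒suc≤ α<β _ = α<β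

-- The bound `α ≤ g n` unfolds to `f m < g n` for every `m`; induction weakens this to `f m ≤ g n`,
-- so the same index `n` serves each `m`.
<⇒≤ : ∀ {α β} → α < β → α ≤ β
<⇒≤ {zero}              _            = _
<⇒≤ {lub⁺ f} {lub⁺ g} (n , α≤gn) m = n , <⇒≤ (α≤gn m)

⇔-neg : ∀ {A B : Set} → A ⇔ B → (¬ A) ⇔ (¬ B)
⇔-neg e = mk⇔ (_∘ from e) (_∘ to e)

≡⇒⇔ : ∀ {A : Set} (P : A → Set) {x y} → x ≡ y → P x ⇔ P y
≡⇒⇔ P refl = ⇔-refl

-- Satisfaction under `≈`, substitution and quantifier blocks.

module _ {V : Vocabulary} where

  ≈-sym : ∀ {n} {φ ψ : Formula V n} → φ ≈ ψ → ψ ≈ φ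
  ≈-sym rel         = rel
  ≈-sym eq          = eq
  ≈-sym (neg e)     = neg (≈-sym e)
  ≈-sym (and e₁ e₂) = and (≈-sym e₁) (≈-sym e₂)
  ≈-sym (ex e)      = ex (≈-sym e)
  ≈-sym (or l r)    = or (λ j → Product.map₂ ≈-sym (r j)) (λ i → Product.map₂ ≈-sym (l i))

  ≈-refl : ∀ {n} (φ : Formula V n) → φ ≈ φ
  ≈-refl (rel r ts) = rel
  ≈-refl (t ≐′ s)   = eq
  ≈-refl (¬′ φ)     = neg (≈-refl φ)
  ≈-refl (φ ∧′ ψ)   = and (≈-refl φ) (≈-refl ψ)
  ≈-refl (∃′ φ)     = ex (≈-refl φ)
  ≈-refl (⋁′ F)     = or (λ i → i , ≈-refl (F i)) (λ i → i , ≈-refl (F i))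

  module _ {M : Structure V} where

    ≈-sat : ∀ {n} {φ ψ : Formula V n} → φ ≈ ψ → ∀ ρ → M ⊨ φ ⟨ ρ ⟩ ⇔ M ⊨ ψ ⟨ ρ ⟩
    ≈-sat rel         ρ = ⇔-refl
    ≈-sat eq          ρ = ⇔-refl
    ≈-sat (neg e)     ρ = ⇔-neg (≈-sat e ρ)
    ≈-sat (and e₁ e₂) ρ = ≈-sat e₁ ρ ×-⇔ ≈-sat e₂ ρ
    ≈-sat (ex e)      ρ = mk⇔ (Product.map₂ (λ {a} → to (≈-sat e (a ∷ ρ))))
                              (Product.map₂ (λ {a} → from (≈-sat e (a ∷ ρ))))
    ≈-sat (or l r)    ρ =
      mk⇔ (λ (i , s) → let (j , e) = l i in j , to (≈-sat e ρ) s)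
          (λ (j , s) → let (i , e) = r j in i , from (≈-sat e ρ) s)

    lookup-evals : ∀ {n k} (ts : Vec (Term V n) k) ρ i →
                   lookup (evals M ts ρ) i ≡ eval M (lookup ts i) ρ
    lookup-evals (t ∷ ts) ρ zero    = refl
    lookup-evals (t ∷ ts) ρ (suc i) = lookup-evals ts ρ i

    mutual
      eval-subst : ∀ {m n} (t : Term V n) (σ : Vec (Term V m) n) ρ →
                   eval M (t [ σ ]ᵗ) ρ ≡ eval M t (evals M σ ρ)
      eval-subst (var i)    σ ρ = sym (lookup-evals σ ρ i)
      eval-subst (fun f ts) σ ρ = cong (funᴵ M f) (evals-subst ts σ ρ)

      evals-subst : ∀ {m n k} (ts : Vec (Term V n) k) (σ : Vec (Term V m) n) ρ →
                    evals M (ts [ σ ]ᵗˢ) ρ ≡ evals M ts (evals M σ ρ)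
      evals-subst []       σ ρ = refl
      evals-subst (t ∷ ts) σ ρ = cong₂ _∷_ (eval-subst t σ ρ) (evals-subst ts σ ρ)

    evals-tabulate-var : ∀ {m n} (f : Fin n → Fin m) ρ →
                         evals M (tabulate (λ i → var (f i))) ρ ≡ tabulate (λ i → lookup ρ (f i))
    evals-tabulate-var {n = zero}  f ρ = refl
    evals-tabulate-var {n = suc n} f ρ = cong (lookup ρ (f zero) ∷_) (evals-tabulate-var (f ∘ suc) ρ)

    evals-id : ∀ {n} (ρ : Vec ∣ M ∣ n) → evals M idˢ ρ ≡ ρ
    evals-id ρ = trans (evals-tabulate-var id ρ) (tabulate∘lookup ρ)

    evals-wk : ∀ {n} a (ρ : Vec ∣ M ∣ n) → evals M wkˢ (a ∷ ρ) ≡ ρ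
    evals-wk a ρ = trans (evals-tabulate-var suc (a ∷ ρ)) (tabulate∘lookup ρ)

    sat-subst : ∀ {m n} (φ : Formula V n) (σ : Vec (Term V m) n) ρ →
                M ⊨ φ [ σ ] ⟨ ρ ⟩ ⇔ M ⊨ φ ⟨ evals M σ ρ ⟩
    sat-subst (rel r ts) σ ρ = ≡⇒⇔ (relᴵ M r) (evals-subst ts σ ρ)
    sat-subst (t ≐′ s)   σ ρ rewrite eval-subst t σ ρ | eval-subst s σ ρ = ⇔-refl
    sat-subst (¬′ φ)     σ ρ = ⇔-neg (sat-subst φ σ ρ)
    sat-subst (φ ∧′ ψ)   σ ρ = sat-subst φ σ ρ ×-⇔ sat-subst ψ σ ρ
    sat-subst (∃′ φ)     σ ρ = mk⇔ (Product.map₂ (λ {a} → to (under-binder a)))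
                                   (Product.map₂ (λ {a} → from (under-binder a)))
      where
      under-binder : ∀ a → M ⊨ φ [ var zero ∷ (σ [ wkˢ ]ᵗˢ) ] ⟨ a ∷ ρ ⟩ ⇔ M ⊨ φ ⟨ a ∷ evals M σ ρ ⟩
      under-binder a = ≡⇒⇔ (M ⊨ φ ⟨_⟩)
                 -- The substitution is shifted by `wkˢ` under the binder, and evaluating the shift
                 -- at `a ∷ ρ` discards `a` again.
                 (cong (a ∷_) (trans (evals-subst σ wkˢ (a ∷ ρ)) (cong (evals M σ) (evals-wk a ρ))))
               ⇔-∘ sat-subst φ _ (a ∷ ρ)
    sat-subst (⋁′ F)     σ ρ = mk⇔ (Product.map₂ (λ {i} → to (sat-subst (F i) σ ρ)))
                                   (Product.map₂ (λ {i} → from (sat-subst (F i) σ ρ)))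

    sat-inst : ∀ {n} (φ : Formula V (suc n)) t ρ →
               M ⊨ φ [ t ∷ idˢ ] ⟨ ρ ⟩ ⇔ M ⊨ φ ⟨ eval M t ρ ∷ ρ ⟩
    sat-inst φ t ρ = ≡⇒⇔ (M ⊨ φ ⟨_⟩) (cong (eval M t ρ ∷_) (evals-id ρ)) ⇔-∘ sat-subst φ _ ρ

    sat-wk : ∀ {n} (φ : Formula V n) a ρ → M ⊨ wk φ ⟨ a ∷ ρ ⟩ ⇔ M ⊨ φ ⟨ ρ ⟩
    sat-wk φ a ρ = ≡⇒⇔ (M ⊨ φ ⟨_⟩) (evals-wk a ρ) ⇔-∘ sat-subst φ wkˢ (a ∷ ρ)

    -- The recursion strips the innermost quantifier, which binds variable zero; its witness
    -- therefore becomes the head of the block.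
    ∃^-sat : ∀ {n} k (φ : Formula V (k + n)) ρ →
             M ⊨ ∃^ k φ ⟨ ρ ⟩ ⇔ (∃[ b ] M ⊨ φ ⟨ b ++ ρ ⟩)
    ∃^-sat zero    φ ρ = mk⇔ ([] ,_) λ { ([] , s) → s }
    ∃^-sat (suc k) φ ρ =
      mk⇔ (λ s → let (b , a , s′) = to (∃^-sat k (∃′ φ) ρ) s in a ∷ b , s′)
          λ { (a ∷ b , s) → from (∃^-sat k (∃′ φ) ρ) (b , a , s) }

    ∃⋆-sat : ∀ {n} (φ : Formula V n) → M ⊨ ∃⋆ φ ⇔ (∃[ ρ ] M ⊨ φ ⟨ ρ ⟩)
    ∃⋆-sat {zero}  φ = mk⇔ ([] ,_) λ { ([] , s) → s }
    ∃⋆-sat {suc n} φ =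
      mk⇔ (λ s → let (ρ , a , s′) = to (∃⋆-sat (∃′ φ)) s in a ∷ ρ , s′)
          λ { (a ∷ ρ , s) → from (∃⋆-sat (∃′ φ)) (ρ , a , s) }

  -- Closure properties of fragments.

  Closed : Class V → Set
  Closed L = Gen L ⊑ᶜ L

  closed-QF : ∀ {L} → Closed L → ∀ {n} {φ : Formula V n} → QF φ → L n φ
  closed-QF cl rel         = cl _ (rel _ _)
  closed-QF cl eq          = cl _ (eq _ _)
  closed-QF cl (neg q)     = cl _ (neg (base (closed-QF cl q)))
  closed-QF cl (and q₁ q₂) = cl _ (and (base (closed-QF cl q₁)) (base (closed-QF cl q₂)))

  closed-∃^ : ∀ {L} → Closed L → ∀ {n} k {φ : Formula V (k + n)} → L (k + n) φ → L n (∃^ k φ)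
  closed-∃^ cl zero    l = l
  closed-∃^ cl (suc k) l = closed-∃^ cl k (cl _ (ex (base l)))

  closed-∃⋆ : ∀ {L} → Closed L → ∀ {n} {φ : Formula V n} → L n φ → L 0 (∃⋆ φ)
  closed-∃⋆ cl {zero}  l = l
  closed-∃⋆ cl {suc n} l = closed-∃⋆ cl (cl _ (ex (base l)))

-- Classical logic: comparability of ordinals.

module Classical (em : ExcludedMiddle 0ℓ) {V : Vocabulary} where

  dne : {P : Set} → ¬ ¬ P → P
  dne = em⇒dne em

  ≤-<-connex : ∀ α β → α ≤ β ⊎ β < α
  ≤-<-connex zero     β = inj₁ _
  ≤-<-connex (lub⁺ f) β with em {∃[ n ] ¬ (f n < β)}
  ... | no  none         = inj₁ λ n → dne λ fn≮β → none (n , fn≮β)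
  ... | yes (n , fn≮β) = inj₂ (n , ≮⇒≥ (f n) β fn≮β)
    where
    mutual
      ≮⇒≥ : ∀ α β → ¬ (α < β) → β ≤ α
      ≮⇒≥ α zero     _   = _
      ≮⇒≥ α (lub⁺ g) α≮β n = ≰⇒> α (g n) λ α≤gn → α≮β (n , α≤gn)

      ≰⇒> : ∀ α β → ¬ (α ≤ β) → β < α
      ≰⇒> zero     β α≰β = contradiction _ α≰β
      ≰⇒> (lub⁺ f) β α≰β = dne λ β≮α → α≰β λ n → dne λ fn≮β → β≮α (n , ≮⇒≥ (f n) β fn≮β)

  -- Classical satisfaction and soundness of finitary deduction.

  module _ {M : Structure V} where

    ∀^-sat : ∀ {n} k (φ : Formula V (k + n)) ρ →
             M ⊨ ∀^ k φ ⟨ ρ ⟩ ⇔ (∀ b → M ⊨ φ ⟨ b ++ ρ ⟩)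
    ∀^-sat zero    φ ρ = mk⇔ (λ { s [] → s }) (_$ [])
    ∀^-sat (suc k) φ ρ =
      mk⇔ (λ { s (a ∷ b) → dne λ ¬s → to (∀^-sat k (∀′ φ) ρ) s b (a , ¬s) })
          (λ s → from (∀^-sat k (∀′ φ) ρ) λ { b (a , ¬s) → ¬s (s (a ∷ b)) })

    ∀⋆-sat : ∀ {n} (φ : Formula V n) → M ⊨ ∀⋆ φ ⇔ (∀ ρ → M ⊨ φ ⟨ ρ ⟩)
    ∀⋆-sat {zero}  φ = mk⇔ (λ { s [] → s }) (_$ [])
    ∀⋆-sat {suc n} φ =
      mk⇔ (λ { s (a ∷ ρ) → dne λ ¬s → to (∀⋆-sat (∀′ φ)) s ρ (a , ¬s) })
          (λ s → from (∀⋆-sat (∀′ φ)) λ { ρ (a , ¬s) → ¬s (s (a ∷ ρ)) })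

    ⋀-sat : ∀ {n} (F : ℕ → Formula V n) ρ → M ⊨ ⋀′ F ⟨ ρ ⟩ ⇔ (∀ i → M ⊨ F i ⟨ ρ ⟩)
    ⋀-sat F ρ = mk⇔ (λ s i → dne λ ¬s → s (i , ¬s)) λ { s (i , ¬s) → ¬s (s i) }

    wk-sat : ∀ {n} {Γ : List (Formula V n)} {ρ} a →
             All (M ⊨_⟨ ρ ⟩) Γ → All (M ⊨_⟨ a ∷ ρ ⟩) (List.map wk Γ)
    wk-sat a = Allₚ.map⁺ ∘ All.map (λ {ψ} → from (sat-wk ψ a _))

    soundness : ∀ {n} {Γ : List (Formula V n)} {φ} → Γ ⊢ φ →
                ∀ ρ → All (M ⊨_⟨ ρ ⟩) Γ → M ⊨ φ ⟨ ρ ⟩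
    soundness (hyp φ∈Γ)    ρ Γ⊨ = All.lookup Γ⊨ φ∈Γ
    soundness (conv e d)   ρ Γ⊨ = to (≈-sat e ρ) (soundness d ρ Γ⊨)
    soundness (∧I d d′)    ρ Γ⊨ = soundness d ρ Γ⊨ , soundness d′ ρ Γ⊨
    soundness (∧E₁ d)      ρ Γ⊨ = proj₁ (soundness d ρ Γ⊨)
    soundness (∧E₂ d)      ρ Γ⊨ = proj₂ (soundness d ρ Γ⊨)
    soundness (¬I d d′)    ρ Γ⊨ = λ s → soundness d′ ρ (s ∷ Γ⊨) (soundness d ρ (s ∷ Γ⊨))
    soundness (¬E d d′)    ρ Γ⊨ = dne λ s → soundness d′ ρ (s ∷ Γ⊨) (soundness d ρ (s ∷ Γ⊨))
    soundness (∃I {φ = φ} t d) ρ Γ⊨ = eval M t ρ , to (sat-inst φ t ρ) (soundness d ρ Γ⊨)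
    soundness (∃E {ψ = ψ} d d′) ρ Γ⊨ =
      let (a , s) = soundness d ρ Γ⊨
      in to (sat-wk ψ a ρ) (soundness d′ (a ∷ ρ) (s ∷ wk-sat a Γ⊨))
    soundness (⋁I i d)     ρ Γ⊨ = i , soundness d ρ Γ⊨
    soundness (refl t)     ρ Γ⊨ = refl
    soundness (repl φ {t} {s} d d′) ρ Γ⊨ =
      from (sat-inst φ s ρ)
        (≡-subst (λ a → M ⊨ φ ⟨ a ∷ ρ ⟩) (soundness d ρ Γ⊨)
          (to (sat-inst φ t ρ) (soundness d′ ρ Γ⊨)))
    soundness point        ρ Γ⊨ = Structure.point M , refl

    -- By soundness a derived contradiction would hold of `a` in `M`. Every consistency claim about
    -- types below is obtained from a realizer in this way.
    satisfied⇒consistent : ∀ {n} {H : Pred (Formula V n) 0ℓ} {a} →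
                           RealizedBy M H a → FinitarilyConsistent H
    satisfied⇒consistent H⊨ Γ Γ⊆H ψ d =
      let (s , ¬s) = soundness d _ (All.map (H⊨ _) Γ⊆H) in ¬s s

    ↑-realized : ∀ {S n} → M ⊨ᵀ S → (a : Vec ∣ M ∣ n) → RealizedBy M (S ↑ n) a
    ↑-realized M⊨S a _ (ψ , ψ∈S , refl) = from (sat-subst ψ [] a) (M⊨S ψ ψ∈S)

  -- Complete types of tuples.

  ⊤′ : ∀ {n} → Formula V n
  ⊤′ = ∃′ (var zero ≐′ var zero)

  -- The sequence `e` may leave `p`; each term outside `p` is replaced by the fixed member `χ₀`.
  -- Closure under `≈` is used because `Range` is taken up to `≈`.
  enumerate : ∀ {n} {p : Pred (Formula V n) 0ℓ} (e : ℕ → Formula V n) →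
              p ⊆ Range e → (∀ {ψ χ} → ψ ≈ χ → p ψ → p χ) → ∃ p → ∃[ F ] Range F ≐ p
  enumerate {p = p} e p⊆e resp-p (χ₀ , pχ₀) =
    F , (λ { (i , ψ≈Fi) → resp-p (≈-sym ψ≈Fi) (pF i) })
      , λ pψ → let (i , ψ≈ei) = p⊆e pψ
               in i , ≡-subst (_ ≈_) (sym (F-∈ i (resp-p ψ≈ei pψ))) ψ≈ei
    where
    select : ∀ i → Dec (p (e i)) → Formula V _
    select i (yes _) = e i
    select i (no _)  = χ₀

    F : ℕ → Formula V _
    F i = select i em

    pF : ∀ i → p (F i)
    pF i with em {p (e i)}
    ... | yes pei = pei
    ... | no  _   = pχ₀

    F-∈ : ∀ i → p (e i) → F i ≡ e i
    F-∈ i pei with em {p (e i)}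
    ... | yes _    = refl
    ... | no  ¬pei = contradiction pei ¬pei

  tp-enumerate : ∀ {L} → IsFragment L → ∀ {M n} (a : Vec ∣ M ∣ n) → ∃[ F ] Range F ≐ tp L M a
  tp-enumerate (closed , countable) {M} {n} a =
    enumerate (proj₁ (countable n)) (proj₂ (countable n) ∘ proj₁)
      (λ e (l , s) → closed _ (resp e (base l)) , to (≈-sat e a) s)
      -- The default member: it lies in every fragment and holds of every tuple, since structures
      -- are nonempty.
      (⊤′ , closed _ (ex (eq _ _)) , Structure.point M , refl)

  tp-isType : ∀ {N : Node V} → Closed (Lang N) → ∀ {M n} {p : Pred (Formula V n) 0ℓ} →
              M ⊨ᵀ Thy N → (a : Vec ∣ M ∣ n) → p ≐ tp (Lang N) M a → IsType N p
  tp-isType {N} closed {M} {n} {p} M⊨N a (p⊆tp , tp⊆p) = record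
    { inLang     = proj₁ ∘ p⊆tp
    ; consistent = satisfied⇒consistent λ ψ → [ ↑-realized M⊨N a ψ , proj₂ ∘ p⊆tp ]
    -- If `ψ` is not in `p`, it is false of `a`, so `p` contains its negation and adding `ψ` is
    -- inconsistent.
    ; maximal    = λ ψ l con → dne λ ¬pψ →
        con (ψ ∷ ¬′ ψ ∷ [])
          (inj₂ (inj₂ refl)
           ∷ inj₂ (inj₁ (tp⊆p (closed _ (neg (base l)) , λ s → ¬pψ (tp⊆p (l , s)))))
           ∷ [])
          ψ (∧I (hyp (here refl)) (hyp (there (here refl))))
    ; ω-complete = λ F pF → let (l , i , s) = p⊆tp pF in i , tp⊆p (closed _ (or⁻¹ (base l) i) , s)
    }

  -- Closure and completeness of nodes, including limit levels.

  record IsComplete (N : Node V) : Set where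
    field
      closed   : Closed (Lang N)
      complete : ∀ ψ → Lang N 0 ψ → Thy N ψ ⊎ Thy N (¬′ ψ)

  IsωComplete⇒IsComplete : ∀ {N} → IsωComplete N → IsComplete N
  IsωComplete⇒IsComplete c = record
    { closed = proj₁ (IsωComplete.fragment c) ; complete = IsωComplete.complete c }

  module _ {δ} {L : Ord → Class V} (closed : ∀ α → α < δ → Closed (L α))
           (mono : ∀ α β → α ≤ β → β < δ → L α ⊑ᶜ L β) where

    ⋃< : Class V
    ⋃< n ψ = ∃[ α ] (α < δ × L α n ψ)

    -- Each generation rule has at most two premises, and comparability of ordinals puts both into
    -- one `L α`. Rules without premises use the given level below `δ`.
    ⋃<-closed : (∃[ α ] α < δ) → Closed ⋃<
    ⋃<-closed (α₀ , α₀<δ) = go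
      where
      unary : ∀ {m n φ ψ} → (∀ {α} → L α m φ → Gen (L α) n ψ) → ⋃< m φ → ⋃< n ψ
      unary g (α , α<δ , l) = α , α<δ , closed α α<δ _ (g l)

      go : Closed ⋃<
      go n (base l)      = l
      go n (resp e g)    = unary (resp e ∘ base) (go n g)
      go n (rel r ts)    = α₀ , α₀<δ , closed α₀ α₀<δ n (rel r ts)
      go n (eq t s)      = α₀ , α₀<δ , closed α₀ α₀<δ n (eq t s)
      go n (neg g)       = unary (λ l → neg (base l)) (go n g)
      go n (and g₁ g₂) with go n g₁ | go n g₂
      ... | α , α<δ , l₁ | β , β<δ , l₂ with ≤-<-connex α β
      ...   | inj₁ α≤β = β , β<δ , closed β β<δ n (and (base (mono α β α≤β β<δ n l₁)) (base l₂))
      ...   | inj₂ β<α = α , α<δ , closed α α<δ n (and (base l₁) (base (mono β α (<⇒≤ β<α) α<δ n l₂)))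
      go n (ex g)        = unary (λ l → ex (base l)) (go (suc n) g)
      go n (subst σ g)   = unary (subst σ ∘ base) (go _ g)
      go n (neg⁻¹ g)     = unary (neg⁻¹ ∘ base) (go n g)
      go n (and₁ g)      = unary (and₁ ∘ base) (go n g)
      go n (and₂ g)      = unary (and₂ ∘ base) (go n g)
      go n (ex⁻¹ g)      = unary (ex⁻¹ ∘ base) (go _ g)
      go n (or⁻¹ g i)    = unary (λ l → or⁻¹ (base l) i) (go n g)

  Gen-mono : ∀ {X Y : Class V} → X ⊑ᶜ Y → Gen X ⊑ᶜ Gen Y
  Gen-mono X⊑Y n (base x)    = base (X⊑Y n x)
  Gen-mono X⊑Y n (resp e g)  = resp e (Gen-mono X⊑Y n g)
  Gen-mono X⊑Y n (rel r ts)  = rel r ts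
  Gen-mono X⊑Y n (eq t s)    = eq t s
  Gen-mono X⊑Y n (neg g)     = neg (Gen-mono X⊑Y n g)
  Gen-mono X⊑Y n (and g₁ g₂) = and (Gen-mono X⊑Y n g₁) (Gen-mono X⊑Y n g₂)
  Gen-mono X⊑Y n (ex g)      = ex (Gen-mono X⊑Y (suc n) g)
  Gen-mono X⊑Y n (subst σ g) = subst σ (Gen-mono X⊑Y _ g)
  Gen-mono X⊑Y n (neg⁻¹ g)   = neg⁻¹ (Gen-mono X⊑Y n g)
  Gen-mono X⊑Y n (and₁ g)    = and₁ (Gen-mono X⊑Y n g)
  Gen-mono X⊑Y n (and₂ g)    = and₂ (Gen-mono X⊑Y n g)
  Gen-mono X⊑Y n (ex⁻¹ g)    = ex⁻¹ (Gen-mono X⊑Y _ g)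
  Gen-mono X⊑Y n (or⁻¹ g i)  = or⁻¹ (Gen-mono X⊑Y n g) i

  -- At a limit every sentence of the union already occurs at a lower level, whose theory decides
  -- it, and that decision persists.
  IsNode⇒IsComplete : ∀ {φ δ N} → IsNode φ δ N → IsComplete N
  IsNode⇒IsComplete (root _ _ c)        = IsωComplete⇒IsComplete c
  IsNode⇒IsComplete (child _ _ (_ , _ , c)) = IsωComplete⇒IsComplete c
  IsNode⇒IsComplete (limit chain (0<δ , _) nodes mono lang thy) = record
    { closed   = λ n g → from (lang n _)
        (⋃<-closed (λ α α<δ → IsComplete.closed (IsNode⇒IsComplete (nodes α α<δ)))
          (λ α β α≤β β<δ → proj₁ (mono α β α≤β β<δ)) (zero , 0<δ)
          n (Gen-mono (λ m → to (lang m _)) n g))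
    ; complete = λ ψ l → let (α , α<δ , l′) = to (lang 0 ψ) l in
        Sum.map (λ s → from (thy ψ) (α , α<δ , s)) (λ s → from (thy (¬′ ψ)) (α , α<δ , s))
          (IsComplete.complete (IsNode⇒IsComplete (nodes α α<δ)) ψ l′)
    }

  -- Tuples satisfying the same formulas of a fragment.

  Agree : Class V → (M : Structure V) → ∀ {n} → Vec ∣ M ∣ n → (N : Structure V) → Vec ∣ N ∣ n → Set
  Agree L M a N b = ∀ ψ → L _ ψ → M ⊨ ψ ⟨ a ⟩ ⇔ N ⊨ ψ ⟨ b ⟩

  Agree-sym : ∀ L {M N n} {a : Vec ∣ M ∣ n} {b : Vec ∣ N ∣ n} → Agree L M a N b → Agree L N b M a
  Agree-sym L ag ψ l = ⇔-sym (ag ψ l)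

  -- A complete type contains the negation of each formula of the fragment that it omits, so one
  -- direction of preservation gives both.
  realizes-tp⇒Agree : ∀ {L} → Closed L → ∀ {M N n} {a : Vec ∣ M ∣ n} {b : Vec ∣ N ∣ n} →
                      RealizedBy N (tp L M a) b → Agree L M a N b
  realizes-tp⇒Agree cl r ψ l =
    mk⇔ (λ s → r ψ (l , s)) (λ s → dne λ ¬s → r (¬′ ψ) (cl _ (neg (base l)) , ¬s) s)

  -- A formula of the language true of `a` is consistent with `q`, being satisfied together with it
  -- by `a`; by maximality it belongs to `q` and so holds of `b`.
  realizers-Agree : ∀ {S : Node V} → Closed (Lang S) → ∀ {n} {q : Pred (Formula V n) 0ℓ} →
                    IsType S q → ∀ {M N} → M ⊨ᵀ Thy S → ∀ {a b} →
                    RealizedBy M q a → RealizedBy N q b → Agree (Lang S) M a N b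
  realizers-Agree cl q-type M⊨S {a} Ma Nb = realizes-tp⇒Agree cl λ ψ (l , s) →
    Nb ψ (IsType.maximal q-type ψ l (satisfied⇒consistent λ where
      χ (inj₁ χ∈S)         → ↑-realized M⊨S a χ χ∈S
      χ (inj₂ (inj₁ χ∈q))  → Ma χ χ∈q
      _ (inj₂ (inj₂ refl)) → s))

  -- Properties of tuples forced by one formula of a level.

  module _ {φ : Sentence V} (D : SacksData φ) where

    open SacksData D using (T; T-node; T-increasing; T-child)

    Lᵀ : Ord → Class V
    Lᵀ δ = Lang (T δ)

    _⊨T_ : Structure V → Ord → Set
    M ⊨T δ = M ⊨ᵀ Thy (T δ)

    T-closed : ∀ δ → Closed (Lᵀ δ)
    T-closed δ = IsComplete.closed (IsNode⇒IsComplete (T-node δ))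

    -- Countability of the fragment at a limit level is read off the next level.
    T-fragment : ∀ δ → IsFragment (Lᵀ δ)
    T-fragment δ = T-closed δ , λ n →
      let (e , L⊆e) = countable n in e , λ l → L⊆e (proj₁ (T-increasing δ (sucᵒ δ) δ≤sucδ) n l)
      where
      δ≤sucδ : δ ≤ sucᵒ δ
      δ≤sucδ = <⇒≤ {δ} (0 , ≤-refl δ)

      countable : CountableClass (Lᵀ (sucᵒ δ))
      countable = proj₂ (IsωComplete.fragment (proj₂ (proj₂ (T-child δ))))

    ⊨T-mono : ∀ {α β M} → α ≤ β → M ⊨T β → M ⊨T α
    ⊨T-mono α≤β M⊨ ψ s = M⊨ ψ (proj₂ (T-increasing _ _ α≤β) s)

    -- Consequence over `T δ` is taken semantically, over all its models, and `P` is any property of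
    -- tuples. This admits agreement with `a` on a whole fragment as well as satisfaction of a
    -- formula or its failure.
    Forced : Ord → (M : Structure V) → ∀ {n} → Vec ∣ M ∣ n →
             (∀ N → Vec ∣ N ∣ n → Set) → Set₁
    Forced δ M a P = ∃[ H ] (Lᵀ δ _ H × M ⊨ H ⟨ a ⟩ ×
                     (∀ N → N ⊨T δ → ∀ c → N ⊨ H ⟨ c ⟩ → P N c))

    module _ {δ : Ord} {M : Structure V} where

      Forced-map : ∀ {n} {a : Vec ∣ M ∣ n} {P Q} →
                   (∀ N → N ⊨T δ → ∀ c → P N c → Q N c) → Forced δ M a P → Forced δ M a Q
      Forced-map f (H , l , s , force) = H , l , s , λ N N⊨ c → f N N⊨ c ∘ force N N⊨ c

      Forced-× : ∀ {n} {a : Vec ∣ M ∣ n} {P Q} → Forced δ M a P → Forced δ M a Q →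
                 Forced δ M a (λ N c → P N c × Q N c)
      Forced-× (H , l , s , force) (H′ , l′ , s′ , force′) =
        H ∧′ H′ , T-closed δ _ (and (base l) (base l′)) , (s , s′) ,
        λ N N⊨ c (t , t′) → force N N⊨ c t , force′ N N⊨ c t′

      Forced-∃ : ∀ {k n} {a : Vec ∣ M ∣ n} (b : Vec ∣ M ∣ k) {P} → Forced δ M (b ++ a) P →
                 Forced δ M a (λ N c → ∃[ d ] P N (d ++ c))
      Forced-∃ {k} {a = a} b (H , l , s , force) =
        ∃^ k H , closed-∃^ (T-closed δ) k l , from (∃^-sat k H a) (b , s) ,
        λ N N⊨ c t → let (d , t′) = to (∃^-sat k H c) t in d , force N N⊨ (d ++ c) t′

      -- The theory decides the sentence `∃⋆ H`. It cannot refute it, because `a` witnesses it in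
      -- `M`; so every model of `T δ` contains a tuple satisfying `H`.
      Forced-transfer : M ⊨T δ → ∀ {n} {a : Vec ∣ M ∣ n} {P} → Forced δ M a P →
                        ∀ {N} → N ⊨T δ → ∃[ c ] P N c
      Forced-transfer M⊨ {a = a} (H , l , s , force) {N} N⊨
        with IsComplete.complete (IsNode⇒IsComplete (T-node δ)) (∃⋆ H) (closed-∃⋆ (T-closed δ) l)
      ... | inj₁ T∃H  = let (c , t) = to (∃⋆-sat H) (N⊨ _ T∃H) in c , force N N⊨ c t
      ... | inj₂ T¬∃H = contradiction (from (∃⋆-sat H) (a , s)) (M⊨ _ T¬∃H)

      Forced-type : ∀ {β} → β < δ → M ⊨T δ → ∀ {n} (a : Vec ∣ M ∣ n) →
                    Forced δ M a (Agree (Lᵀ β) M a)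
      Forced-type {β} β<δ M⊨ {n} a = isolate em
        where
        p : Pred (Formula V n) 0ℓ
        p = tp (Lᵀ β) M a

        enum : ∃[ F ] Range F ≐ p
        enum = tp-enumerate (T-fragment β) a

        F : ℕ → Formula V n
        F = proj₁ enum

        p-F : ∀ i → p (F i)
        p-F i = proj₁ (proj₂ enum) (i , ≈-refl (F i))

        agree : ∀ {N} {c : Vec ∣ N ∣ n} → RealizedBy N p c → Agree (Lᵀ β) M a N c
        agree = realizes-tp⇒Agree (T-closed β)

        isolate : Dec (Principal (Thy (T β)) (Range F)) → Forced δ M a (Agree (Lᵀ β) M a)
        -- A generator lies in the language of level `β`; its implications belong to `T β` and hence
        -- hold in every model of `T δ`.
        isolate (yes (G , G∈F , gen)) =
          G , proj₁ (T-increasing β δ (<⇒≤ β<δ)) n (proj₁ pG) , proj₂ pG ,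
          λ N N⊨ c s → agree λ ψ pψ → dne λ ¬ψ →
            to (∀⋆-sat (G ⇒′ ψ)) (⊨T-mono (<⇒≤ β<δ) N⊨ _ (gen ψ (proj₂ (proj₂ enum) pψ))) c (s , ¬ψ)
          where
          pG : p G
          pG = proj₁ (proj₂ enum) G∈F
        -- The conjunction enters the language at level `β + 1`, which is at most `δ` because
        -- `β < δ` is strict.
        isolate (no nonprincipal) =
          ⋀′ F ,
          proj₁ (T-increasing (sucᵒ β) δ (<⇒suc≤ {β} β<δ)) n
            (proj₂ (proj₁ (T-child β) n)
              (base (inj₂ (F , refl , tp-isType (T-closed β) (⊨T-mono (<⇒≤ β<δ) M⊨) a (proj₂ enum)
                                    , nonprincipal)))) ,
          from (⋀-sat F a) (proj₂ ∘ p-F) ,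
          λ N N⊨ c s → agree λ ψ pψ →
            let (i , ψ≈Fi) = proj₂ (proj₂ enum) pψ
            in from (≈-sat ψ≈Fi c) (to (⋀-sat F c) s i)

    -- Simultaneous induction on infinitary formulas.

    mutual
      Forced-Σ : ∀ {δ n M} {ψ : Formula V n} → Σⁱⁿ δ ψ → M ⊨T δ → ∀ {a} → M ⊨ ψ ⟨ a ⟩ →
                 Forced δ M a (_⊨ ψ ⟨_⟩)
      Forced-Σ (qf q)   M⊨ s       = _ , closed-QF (T-closed _) q , s , λ _ _ _ t → t
      Forced-Σ (or _ F) M⊨ (i , s) = Forced-map (λ _ _ _ t → i , t) (Forced-∃Π (F i) M⊨ s)

      -- With witnesses `b` fixed, a single formula isolates the type of `b ++ a` at level `β`. By
      -- induction that type settles the matrix, and quantifying `b` away leaves a formula about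
      -- `a`.
      Forced-∃Π : ∀ {δ n M} {ψ : Formula V n} → ∃Π δ ψ → M ⊨T δ → ∀ {a} → M ⊨ ψ ⟨ a ⟩ →
                  Forced δ M a (_⊨ ψ ⟨_⟩)
      Forced-∃Π (ex k {ψ} β<δ π) M⊨ {a} s =
        let (b , s′) = to (∃^-sat k ψ a) s
        in Forced-map
             (λ N N⊨ c (d , ag) → from (∃^-sat k ψ c)
               (d , Agree-Π π (⊨T-mono (<⇒≤ β<δ) M⊨) (⊨T-mono (<⇒≤ β<δ) N⊨) ag s′))
             (Forced-∃ b (Forced-type β<δ M⊨ (b ++ a)))

      Forced-¬Π : ∀ {δ n M} {ψ : Formula V n} → Πⁱⁿ δ ψ → M ⊨T δ → ∀ {a} → ¬ M ⊨ ψ ⟨ a ⟩ →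
                  Forced δ M a (λ N c → ¬ N ⊨ ψ ⟨ c ⟩)
      Forced-¬Π (qf q)    M⊨ ¬s = _ , closed-QF (T-closed _) (neg q) , ¬s , λ _ _ _ t → t
      Forced-¬Π (and _ F) M⊨ ¬s =
        let (i , ¬sᵢ) = dne ¬s
        in Forced-map (λ _ _ _ ¬t t → t (i , ¬t)) (Forced-¬∀Σ (F i) M⊨ ¬sᵢ)

      -- Here `b` is a counterexample in `M`. Agreement is used backwards: if the matching tuple `d`
      -- of `N` satisfied the matrix, so would `b`.
      Forced-¬∀Σ : ∀ {δ n M} {ψ : Formula V n} → ∀Σ δ ψ → M ⊨T δ → ∀ {a} → ¬ M ⊨ ψ ⟨ a ⟩ →
                   Forced δ M a (λ N c → ¬ N ⊨ ψ ⟨ c ⟩)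
      Forced-¬∀Σ (all k {ψ} β<δ σ) M⊨ {a} ¬s =
        let (b , ¬s′) = dne λ none → ¬s (from (∀^-sat k ψ a) λ b → dne λ ¬s′ → none (b , ¬s′))
        in Forced-map
             (λ N N⊨ c (d , ag) t →
               ¬s′ (Agree-Σ σ (⊨T-mono (<⇒≤ β<δ) N⊨) (⊨T-mono (<⇒≤ β<δ) M⊨) (Agree-sym (Lᵀ _) ag) (to (∀^-sat k ψ c) t d)))
             (Forced-∃ b (Forced-type β<δ M⊨ (b ++ a)))

      Agree-Σ : ∀ {δ n M N} {ψ : Formula V n} → Σⁱⁿ δ ψ → M ⊨T δ → N ⊨T δ → ∀ {a b} →
                Agree (Lᵀ δ) M a N b → M ⊨ ψ ⟨ a ⟩ → N ⊨ ψ ⟨ b ⟩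
      Agree-Σ σ M⊨ N⊨ ag s =
        let (H , l , t , force) = Forced-Σ σ M⊨ s in force _ N⊨ _ (to (ag H l) t)

      -- A contrapositive: failure at `b` is forced by a formula of the level that is true of `b`;
      -- agreement makes it true of `a`, where `ψ` would fail too.
      Agree-Π : ∀ {δ n M N} {ψ : Formula V n} → Πⁱⁿ δ ψ → M ⊨T δ → N ⊨T δ → ∀ {a b} →
                Agree (Lᵀ δ) M a N b → M ⊨ ψ ⟨ a ⟩ → N ⊨ ψ ⟨ b ⟩
      Agree-Π π M⊨ N⊨ ag s = dne λ ¬t →
        let (H , l , t , force) = Forced-¬Π π N⊨ ¬t in force _ M⊨ _ (from (ag H l) t) s

    -- Transfer of types and of support between models of `T κ`.

    Φ-⊆ : ∀ {κ M N n} {q : Pred (Formula V n) 0ℓ} → M ⊨T κ → N ⊨T κ → IsType (T κ) q →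
          Realizes N q → Φ κ M q ⊆ Φ κ N q
    Φ-⊆ M⊨ N⊨ q-type (b , Nb) (π , a , Ma , s) =
      π , b , Nb , Agree-Π π M⊨ N⊨ (realizers-Agree (T-closed _) q-type M⊨ Ma Nb) s

    Supports-transfer : ∀ {κ M N n} {Γ : Pred (Formula V n) 0ℓ} {θ} → M ⊨T κ → N ⊨T κ →
                        Γ ⊆ Πⁱⁿ κ → Supports κ M Γ θ → Supports κ N Γ θ
    Supports-transfer {N = N} {θ = θ} M⊨ N⊨ Γ⊆Π (σ , ∃θ , θ⇒Γ) =
      σ ,
      (let (_ , s) = to (∃⋆-sat θ) ∃θ
       in from (∃⋆-sat θ) (Forced-transfer M⊨ (Forced-Σ σ M⊨ s) N⊨)) ,
      λ γ γ∈Γ → from (∀⋆-sat (θ ⇒′ γ)) λ c (s , ¬t) →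
        -- The transfer now runs from `N` back to `M`: a counterexample `c` to support in `N` yields
        -- one in `M`, since one formula forces both `θ` and the failure of `γ`.
        let (a , s′ , ¬t′) =
              Forced-transfer N⊨ (Forced-× (Forced-Σ σ N⊨ s) (Forced-¬Π (Γ⊆Π γ∈Γ) N⊨ ¬t)) M⊨
        in to (∀⋆-sat (θ ⇒′ γ)) (θ⇒Γ γ γ∈Γ) a (s′ , ¬t′)

mainTheorem10 : (∀ ℓ → ExcludedMiddle ℓ) →
    (V : Vocabulary) (φ : Sentence V) → MinimalCounterexample φ →
    (D : SacksData φ) →
    (κ : Ord) → S° D κ →
    (M M′ : Structure V) → IsFiberModel D κ M → IsFiberModel D κ M′ →
    (n : ℕ) (q : Pred (Formula V n) 0ℓ) → IsType (SacksData.T D κ) q →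
    Realizes M q → Realizes M′ q →
    (θ : Formula V n) → Supports κ M (Φ κ M q) θ →
    (Φ κ M′ q ≐ Φ κ M q) × Supports κ M′ (Φ κ M q) θ
mainTheorem10 em V φ _ D κ _ M M′ (M⊨ , _) (M′⊨ , _) n q q-type Mq M′q θ supports =
  -- Each inclusion takes its witness from the model on its right-hand side, which is where
  -- realization of `q` in both models enters.
  (Φ-⊆ D M′⊨ M⊨ q-type Mq , Φ-⊆ D M⊨ M′⊨ q-type M′q) ,
  Supports-transfer D M⊨ M′⊨ proj₁ supports
  where open Classical (em 0ℓ)
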